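{- Let $G=(V,E)$ be a finite directed graph with $V=\{0,\dots,n-1\}$, $n$ odd, in which every vertex has odd in-degree, and let $A=A_G$ be the Majority Boolean Automata Network on $G$. Then $A$ solves the Density Classification Task if and only if $G$ contains none of the following patterns: (i) a leader subset $S\subseteq V$ (of size $|S|<\frac{|V|}{2}$); (ii) a non-empty maximal self-sufficient subset $S\subseteq V$ distinct from $V$; (iii) a self-sufficient $m$-cycle $(S_0,\dots,S_{m-1})$, for some $m\geq 2$ (with $S_i\neq V$ for all $0\le i<m$).
   Context: Directed graphs may have loops. $N_G(v)$ is the set of in-neighbors of $v$ in $G$ (containing $v$ if there is a loop at $v$). For a Boolean vector $y$ of odd length, $\mathtt{maj}(y)\in\{0,1\}$ is the most represented value among its entries. The Majority Boolean Automata Network (MBAN) on $G$ is the map $A_G:\{0,1\}^n\to\{0,1\}^n$ with $A_G(x)_v=\mathtt{maj}(x_{N_G(v)})$ for all $v\in V$, where $x_W$ is the restriction of $x$ to $W\subseteq V$. The MBAN $A$ solves the Density Classification Task (DCT) when for every $x\in\{0,1\}^n$ there is $t\in\mathbb{N}$ such that $A^t(x)=\mathtt{maj}(x)^n$ (the uniform configuration all of whose entries are $\mathtt{maj}(x)$). For $S\subseteq V$, the major of $S$ is $M(S)=\{u\in V : |N_G(u)\cap S|>\frac{|N_G(u)|}{2}\}$. A subset $S$ is a leader when $|S|<\frac{|V|}{2}$ and $|M(S)|>\frac{|V|}{2}$. A subset $S$ is self-sufficient when $S\subseteq M(S)$, and maximal self-sufficient when $S=M(S)$. An $m$-tuple $(S_0,\dots,S_{m-1})$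 of distinct (not necessarily disjoint) subsets of $V$ is a self-sufficient $m$-cycle when $M(S_i)=S_{i+1 \bmod m}$ and $S_i\neq V$ for all $0\le i<m$. -}

module Defs where

open import Data.Bool using (Bool; true; false; _≟_)
open import Data.Fin using (Fin; toℕ)
open import Data.Fin.Subset using (Subset; ∣_∣; _∩_; ⊤)
open import Data.Nat using (ℕ; suc; _*_; _<_; _≤_; _<?_; _%_; NonZero)
open import Data.Nat.DivMod using (_mod_)
open import Data.Nat.GeneralisedArithmetic using (iterate)
open import Data.Product using (Σ-syntax; ∃-syntax; _×_)
open import Data.Vec using (Vec; []; _∷_; count; replicate; tabulate)
open import Function.Definitions using (Injective)
open import Level using (0ℓ)
open import Relation.Binary using (Rel; Decidable)
open import Relation.Binary.PropositionalEquality using (_≡_; _≢_)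
open import Relation.Nullary using (does)

Odd : ℕ → Set
Odd k = k % 2 ≡ 1

-- E u v is an arc from u to v; loops are allowed.
record Digraph (n : ℕ) : Set₁ where
  field
    E  : Rel (Fin n) 0ℓ
    E? : Decidable E

  N : Fin n → Subset n
  N v = tabulate (λ u → does (E? u v))

open Digraph public using (N)

OddInDegrees : ∀ {n} → Digraph n → Set
OddInDegrees G = ∀ v → Odd ∣ N G v ∣

-- The values 0 and 1 are false and true.
Config : ℕ → Set
Config n = Vec Bool n

-- Only meaningful for odd k, where there are no ties (a tie would give false).
maj : ∀ {k} → Vec Bool k → Bool
maj y = does (count (_≟ false) y <? count (_≟ true) y)

restrict : ∀ {A : Set} {n} (W : Subset n) → Vec A n → Vec A ∣ W ∣
restrict []          []      = []
restrict (true  ∷ W) (a ∷ x) = a ∷ restrict W x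
restrict (false ∷ W) (a ∷ x) = restrict W x

MBAN : ∀ {n} → Digraph n → Config n → Config n
MBAN G x = tabulate (λ v → maj (restrict (N G v) x))

SolvesDCT : ∀ {n} → (Config n → Config n) → Set
SolvesDCT {n} A = ∀ x → ∃[ t ] iterate A x t ≡ replicate n (maj x)

-- Comparisons with half a cardinality are written with both sides doubled.
M : ∀ {n} → Digraph n → Subset n → Subset n
M G S = tabulate (λ u → does (∣ N G u ∣ <? 2 * ∣ N G u ∩ S ∣))

Leader : ∀ {n} → Digraph n → Subset n → Set
Leader {n} G S = 2 * ∣ S ∣ < n × n < 2 * ∣ M G S ∣

MaximalSelfSufficient : ∀ {n} → Digraph n → Subset n → Set
MaximalSelfSufficient G S = S ≡ M G S

record IsSelfSufficientCycle {n} (G : Digraph n) (m : ℕ) .{{_ : NonZero m}}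
                             (S : Fin m → Subset n) : Set where
  field
    distinct : Injective _≡_ _≡_ S
    step     : ∀ i → M G (S i) ≡ S (suc (toℕ i) mod m)
    proper   : ∀ i → S i ≢ ⊤

HasSelfSufficientCycle : ∀ {n} → Digraph n → Set
HasSelfSufficientCycle {n} G =
  ∃[ m ] Σ[ m≢0 ∈ NonZero m ] (2 ≤ m ×
    (∃[ S ] IsSelfSufficientCycle G m {{m≢0}} S))

{-# OPTIONS --safe #-}

-- As a map on subsets the network is x ↦ M x, so the three patterns are a change of majority in
-- one step, a non-uniform fixed point, and a longer limit cycle.  Every orbit of a finite system
-- ends in a limit cycle, hence without (ii) and (iii) it ends in a uniform configuration; without
-- (i) its majority never changes.  Since (i) only excludes a change from 0 to 1, the change from 1
-- to 0 is excluded by complementation, which commutes with M because all in-degrees are odd.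
module Submission where

open import Defs
open import Data.Bool using (Bool; true; false; not)
import Data.Bool as Bool
open import Data.Bool.Properties using (not-involutive)
open import Data.Fin using (Fin; toℕ; zero; finToFun; funToFin)
open import Data.Fin.Properties using (toℕ-injective; toℕ<n; toℕ-fromℕ<; any?; pigeonhole;
  finToFun-funToFin; 2↔Bool)
open import Data.Fin.Subset using (Subset; Nonempty; ⊤; ⊥; ∁; ∣_∣; _∩_; _∈_)
open import Data.Fin.Subset.Properties using (Empty-unique; nonempty?; ∉⊥; ∣∁p∣≡n∸∣p∣; ∣p∣≤n; ∣⊥∣≡0)
open import Data.Nat using (ℕ; zero; suc; _+_; _*_; _^_; _≤_; _<_; _<?_; _%_; NonZero; z≤n; s≤s)
open import Data.Nat.DivMod using (_mod_; m%n<n; m<n⇒m%n≡m; n%n≡0; m*n%n≡0)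
open import Data.Nat.GeneralisedArithmetic using (iterate)
open import Data.Nat.Induction using (Acc; acc; <-wellFounded)
open import Data.Nat.Properties
open import Data.Product using (Σ-syntax; ∃-syntax; _×_; _,_)
open import Data.Sum using (_⊎_; inj₁; inj₂; map₁)
open import Data.Vec using (Vec; []; _∷_; count; replicate; tabulate; lookup)
open import Data.Vec.Properties using (≡-dec; lookup-replicate; tabulate∘lookup; tabulate-cong;
  tabulate-∘; map-replicate; map-∘; map-cong; map-id)
open import Function using (_∘_; Inverse)
open import Function.Bundles using (_⇔_; mk⇔)
open import Function.Definitions using (Injective)
open import Relation.Binary using (DecidableEquality; tri<; tri≈; tri>)
open import Relation.Binary.PropositionalEquality
  using (_≡_; _≢_; refl; sym; trans; cong; subst; module ≡-Reasoning)
open import Relation.Nullary using (¬_; Dec; does; yes; no; _×-dec_; contradiction)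
open import Relation.Nullary.Decidable using (dec-true; dec-false; does-⇔)

-- Decisions and parity

does-true⇒ : ∀ {P : Set} (P? : Dec P) → does P? ≡ true → P
does-true⇒ (yes p) _ = p

does-false⇒ : ∀ {P : Set} (P? : Dec P) → does P? ≡ false → ¬ P
does-false⇒ (no ¬p) _ = ¬p

odd⇒≢2* : ∀ {k} → Odd k → ∀ a → k ≢ 2 * a
odd⇒≢2* odd a refl with () ← trans (sym odd) (trans (cong (_% 2) (*-comm 2 a)) (m*n%n≡0 a 2))

-- Orbits

module _ {A : Set} (f : A → A) where

  iterate-suc : ∀ x k → iterate f x (suc k) ≡ f (iterate f x k)
  iterate-suc x zero    = refl
  iterate-suc x (suc k) = iterate-suc (f x) k

  iterate-+ : ∀ x i j → iterate f x (i + j) ≡ iterate f (iterate f x i) j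
  iterate-+ x zero    j = refl
  iterate-+ x (suc i) j = iterate-+ (f x) i j

  iterate-fixed : ∀ {x} → f x ≡ x → ∀ k → iterate f x k ≡ x
  iterate-fixed         fx≡x zero    = refl
  iterate-fixed {x = x} fx≡x (suc k) = trans (cong (λ y → iterate f y k) fx≡x) (iterate-fixed fx≡x k)

  -- `IsSelfSufficientCycle` for an arbitrary map, without `proper`. For the network that field is
  -- recovered later from the fact that `⊤` is a fixed point.
  record IsCycle (m : ℕ) .{{_ : NonZero m}} (S : Fin m → A) : Set where
    field
      distinct : Injective _≡_ _≡_ S
      step     : ∀ i → f (S i) ≡ S (suc (toℕ i) mod m)

  HasLongCycle : Set
  HasLongCycle = ∃[ m ] Σ[ m≢0 ∈ NonZero m ] (2 ≤ m × (∃[ S ] IsCycle m {{m≢0}} S))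

  ReachesFixedPoint : A → Set
  ReachesFixedPoint x = ∃[ k ] f (iterate f x k) ≡ iterate f x k

  reaches-fixed-+ : ∀ x i → ReachesFixedPoint (iterate f x i) → ReachesFixedPoint x
  reaches-fixed-+ x i (k , fixed) = i + k , subst (λ y → f y ≡ y) (sym (iterate-+ x i k)) fixed

-- If the successor does not wrap around, it exceeds `i`. If it wraps around, it is 0, so `i` is 0
-- and `m` is 1.
suc-mod≢ : ∀ {m} .{{_ : NonZero m}} → 2 ≤ m → (i : Fin m) → suc (toℕ i) mod m ≢ i
suc-mod≢ {m} 2≤m i eq = by-cases (m≤n⇒m<n∨m≡n (toℕ<n i))
  where
  suc%≡ : suc (toℕ i) % m ≡ toℕ i
  suc%≡ = trans (sym (toℕ-fromℕ< (m%n<n (suc (toℕ i)) m))) (cong toℕ eq)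

  by-cases : ¬ (suc (toℕ i) < m ⊎ suc (toℕ i) ≡ m)
  by-cases (inj₁ lt) = 1+n≢n (trans (sym (m<n⇒m%n≡m lt)) suc%≡)
  by-cases (inj₂ ≡m) = <⇒≢ 2≤m (trans (cong suc (sym i≡0)) ≡m)
    where
    i≡0 : toℕ i ≡ 0
    i≡0 = trans (sym suc%≡) (trans (cong (_% m) ≡m) (n%n≡0 m))

module _ {A : Set} {f : A → A} {m} .{{_ : NonZero m}} {S : Fin m → A} (cycle : IsCycle f m S) where
  open IsCycle cycle

  cycle-no-fixed-point : 2 ≤ m → ∀ i → f (S i) ≢ S i
  cycle-no-fixed-point 2≤m i fixed = suc-mod≢ 2≤m i (distinct (trans (sym (step i)) fixed))

  -- Whatever an orbit starting on a cycle ends in must itself lie on the cycle, where no fixed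
  -- point is possible once `2 ≤ m`.
  cycle-invariant : ∀ i t → ∃[ j ] iterate f (S i) t ≡ S j
  cycle-invariant i zero    = i , refl
  cycle-invariant i (suc t) with j , eq ← cycle-invariant (suc (toℕ i) mod m) t
    = j , trans (cong (λ y → iterate f y t) (step i)) eq

module _ {A : Set} (_≟_ : DecidableEquality A) (f : A → A) where

  private
    -- A repetition among the first p iterates gives a periodic point of smaller period.
    go : ∀ p → Acc _<_ p → ∀ x → iterate f x (suc p) ≡ x → ReachesFixedPoint f x ⊎ HasLongCycle f
    go zero    _         x fx≡x   = inj₁ (0 , fx≡x)
    go (suc p) (acc rec) x period
      with any? {n = suc (suc p)} (λ i → any? {n = suc (suc p)} (λ j →
             (toℕ i <? toℕ j) ×-dec (iterate f x (toℕ i) ≟ iterate f x (toℕ j))))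
    ... | yes (i , j , i<j , eq) = by-descent (m≤n⇒∃[o]m+o≡n i<j)
      where
      by-descent : ∃[ d ] suc (toℕ i) + d ≡ toℕ j → ReachesFixedPoint f x ⊎ HasLongCycle f
      by-descent (d , i+1+d≡j) =
        map₁ (reaches-fixed-+ f x (toℕ i)) (go d (rec d<) (iterate f x (toℕ i)) shorter)
        where
        i+suc-d≡j : toℕ i + suc d ≡ toℕ j
        i+suc-d≡j = trans (+-suc (toℕ i) d) i+1+d≡j

        -- The new period `suc d` is the gap between `i` and `j`, at most `suc p`, hence below the
        -- old period `suc (suc p)`.
        d< : d < suc p
        d< = ≤-trans (m≤n+m (suc d) (toℕ i)) (≤-trans (≤-reflexive i+suc-d≡j) (m<1+n⇒m≤n (toℕ<n j)))

        shorter : iterate f (iterate f x (toℕ i)) (suc d) ≡ iterate f x (toℕ i)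
        shorter = trans (sym (iterate-+ f x (toℕ i) (suc d)))
                    (trans (cong (iterate f x) i+suc-d≡j) (sym eq))
    -- The iterates over one full period are pairwise distinct, so they form a cycle whose length is
    -- that period, at least 2.
    ... | no ¬repeat =
      inj₂ (m , _ , s≤s (s≤s z≤n) , S , record { distinct = distinct ; step = step })
      where
      m = suc (suc p)

      S : Fin m → A
      S i = iterate f x (toℕ i)

      distinct : Injective _≡_ _≡_ S
      distinct {i} {j} eq with <-cmp (toℕ i) (toℕ j)
      ... | tri< i<j _ _ = contradiction (i , j , i<j , eq) ¬repeat
      ... | tri≈ _ i≡j _ = toℕ-injective i≡j
      ... | tri> _ _ j<i = contradiction (j , i , j<i , sym eq) ¬repeat

      wrap : ∀ i → suc (toℕ i) < m ⊎ suc (toℕ i) ≡ m →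
             iterate f x (suc (toℕ i)) ≡ iterate f x (suc (toℕ i) % m)
      wrap i (inj₁ lt) = cong (iterate f x) (sym (m<n⇒m%n≡m lt))
      -- After the last index, periodicity leads back to `x`, the iterate with index 0.
      wrap i (inj₂ ≡m) = trans (cong (iterate f x) ≡m) (trans period
        (cong (iterate f x) (sym (trans (cong (_% m) ≡m) (n%n≡0 m)))))

      step : ∀ i → f (S i) ≡ S (suc (toℕ i) mod m)
      step i = trans (sym (iterate-suc f x (toℕ i))) (trans (wrap i (m≤n⇒m<n∨m≡n (toℕ<n i)))
        (cong (iterate f x) (sym (toℕ-fromℕ< (m%n<n (suc (toℕ i)) m)))))

  periodic⇒fixed⊎cycle : ∀ p x → iterate f x (suc p) ≡ x → ReachesFixedPoint f x ⊎ HasLongCycle f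
  periodic⇒fixed⊎cycle p = go p (<-wellFounded p)

-- A configuration as the binary digits of a number, because the pigeonhole principle is applied to
-- maps between `Fin` types.
encode : ∀ {n} → Config n → Fin (2 ^ n)
encode x = funToFin (Inverse.from 2↔Bool ∘ lookup x)

encode-injective : ∀ {n} → Injective _≡_ _≡_ (encode {n})
encode-injective {x = x} {y} eq =
  trans (sym (tabulate∘lookup x)) (trans (tabulate-cong same) (tabulate∘lookup y))
  where
  open ≡-Reasoning
  decode : ∀ z i → Inverse.to 2↔Bool (finToFun (encode z) i) ≡ lookup z i
  decode z i = trans (cong (Inverse.to 2↔Bool) (finToFun-funToFin (Inverse.from 2↔Bool ∘ lookup z) i))
    (Inverse.strictlyInverseˡ 2↔Bool (lookup z i))

  same : ∀ i → lookup x i ≡ lookup y i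
  same i = begin
    lookup x i                                 ≡⟨ decode x i ⟨
    Inverse.to 2↔Bool (finToFun (encode x) i)  ≡⟨ cong (λ c → Inverse.to 2↔Bool (finToFun c i)) eq ⟩
    Inverse.to 2↔Bool (finToFun (encode y) i)  ≡⟨ decode y i ⟩
    lookup y i                                 ∎

eventually-periodic : ∀ {n} (f : Config n → Config n) x →
  ∃[ i ] ∃[ p ] iterate f (iterate f x i) (suc p) ≡ iterate f x i
eventually-periodic {n} f x
  -- There are `2 ^ n` codes and one more iterate than that, so two iterates coincide; the period is
  -- the difference of their indices.
  with i , j , i<j , eq ← pigeonhole (n<1+n (2 ^ n)) (λ i → encode (iterate f x (toℕ i)))
  with d , i+1+d≡j ← m≤n⇒∃[o]m+o≡n i<j
  = toℕ i , d , trans (sym (iterate-+ f x (toℕ i) (suc d)))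
      (trans (cong (iterate f x) (trans (+-suc (toℕ i) d) i+1+d≡j)) (sym (encode-injective eq)))

reaches-fixed⊎cycle : ∀ {n} (f : Config n → Config n) x → ReachesFixedPoint f x ⊎ HasLongCycle f
reaches-fixed⊎cycle f x
  with i , p , period ← eventually-periodic f x
  = map₁ (reaches-fixed-+ f x i) (periodic⇒fixed⊎cycle (≡-dec Bool._≟_) f p (iterate f x i) period)

-- Majorities

count-false : ∀ {k} (y : Vec Bool k) → count (Bool._≟ false) y ≡ ∣ ∁ y ∣
count-false []          = refl
count-false (true  ∷ y) = count-false y
count-false (false ∷ y) = cong suc (count-false y)

∣∁y∣+∣y∣≡k : ∀ {k} (y : Vec Bool k) → ∣ ∁ y ∣ + ∣ y ∣ ≡ k
∣∁y∣+∣y∣≡k y = trans (cong (_+ ∣ y ∣) (∣∁p∣≡n∸∣p∣ y)) (m∸n+n≡m (∣p∣≤n y))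

double : ∀ a → a + a ≡ 2 * a
double a = cong (a +_) (sym (+-identityʳ a))

-- Adding the number of ones to both sides turns "fewer zeros than ones" into the doubled comparison
-- used by `M` and `Leader`.
maj≡half< : ∀ {k} (y : Vec Bool k) → maj y ≡ does (k <? 2 * ∣ y ∣)
maj≡half< {k} y = does-⇔ (mk⇔ to from) (count (Bool._≟ false) y <? a) (k <? 2 * ∣ y ∣)
  where
  a = ∣ y ∣
  total : count (Bool._≟ false) y + a ≡ k
  total = trans (cong (_+ a) (count-false y)) (∣∁y∣+∣y∣≡k y)

  to : count (Bool._≟ false) y < a → k < 2 * a
  to lt = subst (_< 2 * a) total (subst (count (Bool._≟ false) y + a <_) (double a) (+-monoˡ-< a lt))

  from : k < 2 * a → count (Bool._≟ false) y < a
  from lt = +-cancelʳ-< a _ _ (subst (_< a + a) (sym total) (subst (k <_) (sym (double a)) lt))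

maj≡true⇒ : ∀ {k} (y : Vec Bool k) → maj y ≡ true → k < 2 * ∣ y ∣
maj≡true⇒ {k} y eq = does-true⇒ (k <? 2 * ∣ y ∣) (trans (sym (maj≡half< y)) eq)

⇒maj≡true : ∀ {k} (y : Vec Bool k) → k < 2 * ∣ y ∣ → maj y ≡ true
⇒maj≡true {k} y lt = trans (maj≡half< y) (dec-true (k <? 2 * ∣ y ∣) lt)

maj≡false⇒ : ∀ {k} (y : Vec Bool k) → Odd k → maj y ≡ false → 2 * ∣ y ∣ < k
maj≡false⇒ {k} y odd eq =
  ≤∧≢⇒< (≮⇒≥ (does-false⇒ (k <? 2 * ∣ y ∣) (trans (sym (maj≡half< y)) eq)))
        (λ e → odd⇒≢2* odd ∣ y ∣ (sym e))

⇒maj≡false : ∀ {k} (y : Vec Bool k) → 2 * ∣ y ∣ ≤ k → maj y ≡ false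
⇒maj≡false {k} y le = trans (maj≡half< y) (dec-false (k <? 2 * ∣ y ∣) (≤⇒≯ le))

∁-involutive : ∀ {k} (y : Vec Bool k) → ∁ (∁ y) ≡ y
∁-involutive y = trans (sym (map-∘ not not y)) (trans (map-cong not-involutive y) (map-id y))

2∣∁y∣+2∣y∣≡k+k : ∀ {k} (y : Vec Bool k) → 2 * ∣ ∁ y ∣ + 2 * ∣ y ∣ ≡ k + k
2∣∁y∣+2∣y∣≡k+k {k} y = trans (sym (*-distribˡ-+ 2 ∣ ∁ y ∣ ∣ y ∣))
  (trans (cong (2 *_) (∣∁y∣+∣y∣≡k y)) (sym (double k)))

-- The doubled sizes of `y` and `∁ y` add up to `k + k`, so one lies above `k` exactly when the
-- other lies below. Oddness enters when `maj y` is false: a tie would stay false after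
-- complementation.
maj-∁ : ∀ {k} → Odd k → (y : Vec Bool k) → maj (∁ y) ≡ not (maj y)
maj-∁ {k} odd y with maj y in eq
... | true  = ⇒maj≡false (∁ y) (<⇒≤ (+-cancelʳ-< (2 * ∣ y ∣) _ _
  (subst (_< k + 2 * ∣ y ∣) (sym (2∣∁y∣+2∣y∣≡k+k y)) (+-monoʳ-< k (maj≡true⇒ y eq)))))
... | false = ⇒maj≡true (∁ y) (+-cancelʳ-< (2 * ∣ y ∣) _ _
  (subst (k + 2 * ∣ y ∣ <_) (sym (2∣∁y∣+2∣y∣≡k+k y)) (+-monoʳ-< k (maj≡false⇒ y odd eq))))

maj-replicate : ∀ k → Odd k → ∀ b → maj (replicate k b) ≡ b
maj-replicate k odd false = ⇒maj≡false ⊥ (subst (λ a → 2 * a ≤ k) (sym (∣⊥∣≡0 k)) z≤n)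
maj-replicate k odd true  = begin
  maj (replicate k true)         ≡⟨ cong maj (map-replicate not false k) ⟨
  maj (∁ (replicate k false))    ≡⟨ maj-∁ odd (replicate k false) ⟩
  not (maj (replicate k false)) ≡⟨ cong not (maj-replicate k odd false) ⟩
  true                           ∎
  where open ≡-Reasoning

-- The network

∣restrict∣ : ∀ {n} (W : Subset n) x → ∣ restrict W x ∣ ≡ ∣ W ∩ x ∣
∣restrict∣ []          []          = refl
∣restrict∣ (true  ∷ W) (true  ∷ x) = cong suc (∣restrict∣ W x)
∣restrict∣ (true  ∷ W) (false ∷ x) = ∣restrict∣ W x
∣restrict∣ (false ∷ W) (_     ∷ x) = ∣restrict∣ W x

restrict-∁ : ∀ {n} (W : Subset n) x → restrict W (∁ x) ≡ ∁ (restrict W x)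
restrict-∁ []          []      = refl
restrict-∁ (true  ∷ W) (a ∷ x) = cong (not a ∷_) (restrict-∁ W x)
restrict-∁ (false ∷ W) (a ∷ x) = restrict-∁ W x

restrict-replicate : ∀ {n} (W : Subset n) (b : Bool) → restrict W (replicate n b) ≡ replicate ∣ W ∣ b
restrict-replicate []          b = refl
restrict-replicate (true  ∷ W) b = cong (b ∷_) (restrict-replicate W b)
restrict-replicate (false ∷ W) b = restrict-replicate W b

-- A configuration and the subset of its ones are the same vector, and at each vertex both maps
-- decide the same inequality.
MBAN≗M : ∀ {n} (G : Digraph n) S → MBAN G S ≡ M G S
MBAN≗M G S = tabulate-cong λ v →
  trans (maj≡half< (restrict (N G v) S))
    (cong (λ a → does (∣ N G v ∣ <? 2 * a)) (∣restrict∣ (N G v) S))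

module _ {n} (G : Digraph n) (oddIn : OddInDegrees G) where

  MBAN-∁ : ∀ x → MBAN G (∁ x) ≡ ∁ (MBAN G x)
  MBAN-∁ x = trans
    (tabulate-cong λ v → trans (cong maj (restrict-∁ (N G v) x)) (maj-∁ (oddIn v) (restrict (N G v) x)))
    (tabulate-∘ not (λ v → maj (restrict (N G v) x)))

  -- Each vertex sees only the value `b`, and sees it at least once, as an odd in-degree is not
  -- zero.
  MBAN-replicate : ∀ b → MBAN G (replicate n b) ≡ replicate n b
  MBAN-replicate b = trans
    (tabulate-cong λ v → trans (cong maj (restrict-replicate (N G v) b))
      (trans (maj-replicate ∣ N G v ∣ (oddIn v) b) (sym (lookup-replicate v b))))
    (tabulate∘lookup (replicate n b))

  module _ (odd : Odd n) where

    -- The orbits of `x` and of its image merge. Uniform configurations are fixed, so at time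
    -- `suc s + t` both have arrived, and the common value is the majority of each.
    solves⇒maj-MBAN : SolvesDCT (MBAN G) → ∀ x → maj (MBAN G x) ≡ maj x
    solves⇒maj-MBAN dct x with t , x-end ← dct x | s , Ax-end ← dct (MBAN G x) = begin
      maj (MBAN G x)                          ≡⟨ maj-replicate n odd _ ⟨
      maj (replicate n (maj (MBAN G x)))      ≡⟨ cong maj (absorbed (suc s) t Ax-end) ⟨
      maj (iterate (MBAN G) x (suc s + t))    ≡⟨ cong (maj ∘ iterate (MBAN G) x) (+-comm (suc s) t) ⟩
      maj (iterate (MBAN G) x (t + suc s))    ≡⟨ cong maj (absorbed t (suc s) x-end) ⟩
      maj (replicate n (maj x))               ≡⟨ maj-replicate n odd _ ⟩
      maj x                                   ∎
      where
      open ≡-Reasoning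
      absorbed : ∀ i j {b} → iterate (MBAN G) x i ≡ replicate n b →
                 iterate (MBAN G) x (i + j) ≡ replicate n b
      absorbed i j {b} eq = trans (iterate-+ (MBAN G) x i j)
        (trans (cong (λ y → iterate (MBAN G) y j) eq) (iterate-fixed (MBAN G) (MBAN-replicate b) j))

    solves⇒no-leader : SolvesDCT (MBAN G) → ¬ (∃[ S ] Leader G S)
    solves⇒no-leader dct (S , small , large)
      with () ← trans (sym (⇒maj≡true (M G S) large)) (trans (cong maj (sym (MBAN≗M G S)))
                  (trans (solves⇒maj-MBAN dct S) (⇒maj≡false S (<⇒≤ small))))

    no-leader⇒maj-stays-false : ¬ (∃[ S ] Leader G S) → ∀ x → maj x ≡ false → maj (MBAN G x) ≡ false
    no-leader⇒maj-stays-false ¬leader x small with maj (MBAN G x) in large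
    ... | false = refl
    ... | true  = contradiction
      (x , maj≡false⇒ x odd small , maj≡true⇒ (M G x) (trans (cong maj (sym (MBAN≗M G x))) large))
      ¬leader

    no-leader⇒maj-MBAN : ¬ (∃[ S ] Leader G S) → ∀ x → maj (MBAN G x) ≡ maj x
    no-leader⇒maj-MBAN ¬leader x with maj x in eq
    ... | false = no-leader⇒maj-stays-false ¬leader x eq
    ... | true  = begin
      maj (MBAN G x)           ≡⟨ cong (maj ∘ MBAN G) (∁-involutive x) ⟨
      maj (MBAN G (∁ (∁ x)))   ≡⟨ cong maj (MBAN-∁ (∁ x)) ⟩
      maj (∁ (MBAN G (∁ x)))   ≡⟨ maj-∁ odd (MBAN G (∁ x)) ⟩
      not (maj (MBAN G (∁ x))) ≡⟨ cong not (no-leader⇒maj-stays-false ¬leader (∁ x)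
                                   (trans (maj-∁ odd x) (cong not eq))) ⟩
      true                     ∎
      where open ≡-Reasoning

    no-leader⇒maj-iterate : ¬ (∃[ S ] Leader G S) → ∀ x k → maj (iterate (MBAN G) x k) ≡ maj x
    no-leader⇒maj-iterate ¬leader x zero    = refl
    no-leader⇒maj-iterate ¬leader x (suc k) =
      trans (no-leader⇒maj-iterate ¬leader (MBAN G x) k) (no-leader⇒maj-MBAN ¬leader x)

    -- Such an `S` is a fixed point, so the uniform configuration it reaches is `S` itself: all ones
    -- contradicts `S ≢ ⊤`, all zeros contradicts non-emptiness.
    solves⇒no-maximal : SolvesDCT (MBAN G) →
      ¬ (∃[ S ] (Nonempty S × MaximalSelfSufficient G S × S ≢ ⊤))
    solves⇒no-maximal dct (S , (v , v∈S) , S≡MS , S≢⊤) with t , end ← dct S | maj S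
    ... | true  = S≢⊤ (trans (sym (iterate-fixed (MBAN G) (trans (MBAN≗M G S) (sym S≡MS)) t)) end)
    ... | false = ∉⊥ (subst (v ∈_)
      (trans (sym (iterate-fixed (MBAN G) (trans (MBAN≗M G S) (sym S≡MS)) t)) end) v∈S)

    -- The orbit of `S zero` would end in a uniform configuration lying on the cycle, which would be
    -- a fixed point there.
    solves⇒no-cycle : SolvesDCT (MBAN G) → ¬ HasSelfSufficientCycle G
    solves⇒no-cycle dct (m@(suc _) , m≢0 , 2≤m , S , S-cycle) =
      let t , end = dct (S zero)
          j , eq  = cycle-invariant cycle zero t
      in cycle-no-fixed-point cycle 2≤m j
           (subst (λ y → MBAN G y ≡ y) (trans (sym end) eq) (MBAN-replicate _))
      where
      open IsSelfSufficientCycle S-cycle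
      cycle : IsCycle (MBAN G) m S
      cycle = record { distinct = distinct ; step = λ i → trans (MBAN≗M G (S i)) (step i) }

    no-cycle⇒reaches-fixed : ¬ HasSelfSufficientCycle G → ∀ x → ReachesFixedPoint (MBAN G) x
    no-cycle⇒reaches-fixed ¬cycle x with reaches-fixed⊎cycle (MBAN G) x
    ... | inj₁ fixed = fixed
    ... | inj₂ (m , m≢0 , 2≤m , S , cycle) = contradiction
      (m , m≢0 , 2≤m , S , record
        { distinct = distinct
        ; step     = λ i → trans (sym (MBAN≗M G (S i))) (step i)
        -- The full set is fixed by the network, while a cycle of length at least 2 contains no
        -- fixed point.
        ; proper   = λ i Si≡⊤ → cycle-no-fixed-point {{m≢0}} cycle 2≤m i
                       (subst (λ y → MBAN G y ≡ y) (sym Si≡⊤) (MBAN-replicate true))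
        }) ¬cycle
      where open IsCycle {{m≢0}} cycle

    fixed⇒uniform : ¬ (∃[ S ] (Nonempty S × MaximalSelfSufficient G S × S ≢ ⊤)) →
      ∀ x → MBAN G x ≡ x → ∃[ b ] x ≡ replicate n b
    fixed⇒uniform ¬maximal x fixed with nonempty? x | ≡-dec Bool._≟_ x ⊤
    ... | no  empty | _       = false , Empty-unique empty
    ... | yes _     | yes x≡⊤ = true , x≡⊤
    ... | yes ne    | no  x≢⊤ =
      contradiction (x , ne , trans (sym fixed) (MBAN≗M G x) , x≢⊤) ¬maximal

    patternless⇒solves : ¬ (∃[ S ] Leader G S) →
      ¬ (∃[ S ] (Nonempty S × MaximalSelfSufficient G S × S ≢ ⊤)) →
      ¬ HasSelfSufficientCycle G → SolvesDCT (MBAN G)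
    patternless⇒solves ¬leader ¬maximal ¬cycle x
      with k , fixed ← no-cycle⇒reaches-fixed ¬cycle x
      with b , uniform ← fixed⇒uniform ¬maximal (iterate (MBAN G) x k) fixed
      = k , trans uniform (cong (replicate n) b≡maj)
      where
      -- Conservation of the majority along the orbit decides which of the two uniform
      -- configurations is reached.
      b≡maj : b ≡ maj x
      b≡maj = trans (sym (maj-replicate n odd b))
        (trans (cong maj (sym uniform)) (no-leader⇒maj-iterate ¬leader x k))

theorem4p9 : ∀ (n : ℕ) → Odd n → (G : Digraph n) → OddInDegrees G →
    SolvesDCT (MBAN G) ⇔
    ( ¬ (∃[ S ] Leader G S)
    × ¬ (∃[ S ] (Nonempty S × MaximalSelfSufficient G S × S ≢ ⊤))
    × ¬ HasSelfSufficientCycle G )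
theorem4p9 n odd G oddIn = mk⇔
  (λ dct → solves⇒no-leader G oddIn odd dct , solves⇒no-maximal G oddIn odd dct , solves⇒no-cycle G oddIn odd dct)
  (λ (¬leader , ¬maximal , ¬cycle) → patternless⇒solves G oddIn odd ¬leader ¬maximal ¬cycle)
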